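{- Let $x_1\geq x_2\geq x_3\geq x_4\geq x_5\geq x_6$ be real numbers such that $x_1+x_6\geq x_2+x_5\geq x_3+x_4$. Let $a_1,\dots,a_6\in\mathbb{R}$ satisfy $a_1\geq |a_2|\geq a_5\geq |a_6|$ and $a_3\geq |a_4|$, and let $g:\mathbb{R}\to\mathbb{R}$ be a function in class $\mathcal{G}_2$. Then $$\sum_{i=1}^6 a_i\prod_{\substack{1\leq j\leq 6\\ j\neq i}} g(x_i-x_j)\geq 0.$$
   Context: A function $g:\mathbb{R}\to\mathbb{R}$ is in class $\mathcal{G}$ if $g$ is either even or odd, $g(0)\geq 0$, and $g$ is monotonically nondecreasing on $[0,\infty)$. A function $g:\mathbb{R}\to\mathbb{R}$ is in class $\mathcal{G}_2$ if $g$ is in class $\mathcal{G}$ and for all $x\geq y\geq 0$ and $z\geq 0$, $$g(x)g(y+z)\geq g(y)g(x+z)\quad\text{and}\quad g(x)+g(y+z)\leq g(y)+g(x+z).$$ -}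

module Defs where

open import Algebra.Bundles using (CommutativeMonoid; RawMonoid)
import Algebra.Definitions.RawMonoid as RawMonoidDefinitions
import Algebra.Properties.AbelianGroup as AbelianGroupProperties
import Algebra.Properties.CommutativeSemigroup as CommutativeSemigroupProperties
open import Data.Nat as ℕ using (ℕ)
import Data.Nat.Properties as ℕ
open import Data.Product using (_×_; _,_; ∃-syntax)
open import Data.Rational as ℚ using (ℚ; 0ℚ; 1ℚ; ½)
import Data.Rational.Properties as ℚ
open import Data.Sum using (_⊎_; inj₁; inj₂)
open import Function.Bundles using (Func)
open import Level using (0ℓ)
open import Relation.Binary.Bundles using (Setoid)
open import Relation.Binary.PropositionalEquality
  using (_≡_; refl; sym; trans; cong; cong₂; subst; respˡ; respʳ)

private
  open AbelianGroupProperties ℚ.+-0-abelianGroup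
    using (⁻¹-anti-homo-//; \\-leftDividesʳ; xyx⁻¹≈y)
  open CommutativeSemigroupProperties (CommutativeMonoid.commutativeSemigroup ℚ.+-0-commutativeMonoid)
    using (interchange)

  telescope : ∀ p q r → (p ℚ.- q) ℚ.+ (q ℚ.- r) ≡ p ℚ.- r
  telescope p q r = trans (ℚ.+-assoc p (ℚ.- q) (q ℚ.- r))
    (cong (p ℚ.+_) (\\-leftDividesʳ q (ℚ.- r)))

  ½ε+½ε≡ε : ∀ ε → ½ ℚ.* ε ℚ.+ ½ ℚ.* ε ≡ ε
  ½ε+½ε≡ε ε = trans (sym (ℚ.*-distribʳ-+ ε ½ ½)) (ℚ.*-identityˡ ε)

  0<½ε : ∀ {ε} → 0ℚ ℚ.< ε → 0ℚ ℚ.< ½ ℚ.* ε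
  0<½ε 0<ε = respˡ ℚ._<_ (ℚ.*-zeroʳ ½) (ℚ.*-monoʳ-<-pos ½ 0<ε)

  ≤+<½⇒< : ∀ {p q r ε} → p ℚ.≤ q ℚ.+ r → q ℚ.< ½ ℚ.* ε → r ℚ.< ½ ℚ.* ε → p ℚ.< ε
  ≤+<½⇒< {ε = ε} p≤q+r q<½ε r<½ε = ℚ.≤-<-trans p≤q+r
    (respʳ ℚ._<_ (½ε+½ε≡ε ε) (ℚ.+-mono-< q<½ε r<½ε))

  divide : ∀ {K ε} → 0ℚ ℚ.< K → 0ℚ ℚ.< ε → ∃[ δ ] 0ℚ ℚ.< δ × K ℚ.* δ ≡ ε
  divide {K} {ε} 0<K 0<ε = δ , 0<δ , K*δ≡ε
    where
    instance
      K-pos = ℚ.positive 0<K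
      K-nonZero = ℚ.pos⇒nonZero K
      1/K-pos = ℚ.1/pos⇒pos K
    δ = ℚ.1/ K ℚ.* ε
    0<δ = respˡ ℚ._<_ (ℚ.*-zeroʳ (ℚ.1/ K)) (ℚ.*-monoʳ-<-pos (ℚ.1/ K) 0<ε)
    K*δ≡ε = trans (sym (ℚ.*-assoc K (ℚ.1/ K) ε))
      (trans (cong (ℚ._* ε) (ℚ.*-inverseʳ K)) (ℚ.*-identityˡ ε))

  ∣p-q∣≡∣q-p∣ : ∀ p q → ℚ.∣ p ℚ.- q ∣ ≡ ℚ.∣ q ℚ.- p ∣
  ∣p-q∣≡∣q-p∣ p q = trans (sym (ℚ.∣-p∣≡∣p∣ (p ℚ.- q))) (cong ℚ.∣_∣ (⁻¹-anti-homo-// p q))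

  ∣p∣≤∣q∣+∣p-q∣ : ∀ p q → ℚ.∣ p ∣ ℚ.≤ ℚ.∣ q ∣ ℚ.+ ℚ.∣ p ℚ.- q ∣
  ∣p∣≤∣q∣+∣p-q∣ p q = subst (λ r → ℚ.∣ r ∣ ℚ.≤ ℚ.∣ q ∣ ℚ.+ ℚ.∣ p ℚ.- q ∣)
    (trans (sym (ℚ.+-assoc q p (ℚ.- q))) (xyx⁻¹≈y q p)) (ℚ.∣p+q∣≤∣p∣+∣q∣ q (p ℚ.- q))

  ∣p-r∣≤∣p-q∣+∣q-r∣ : ∀ p q r →
    ℚ.∣ p ℚ.- r ∣ ℚ.≤ ℚ.∣ p ℚ.- q ∣ ℚ.+ ℚ.∣ q ℚ.- r ∣
  ∣p-r∣≤∣p-q∣+∣q-r∣ p q r = respˡ ℚ._≤_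
    (cong ℚ.∣_∣ (telescope p q r)) (ℚ.∣p+q∣≤∣p∣+∣q∣ (p ℚ.- q) (q ℚ.- r))

  ∣p∣-∣q∣≤∣p-q∣ : ∀ p q → ℚ.∣ p ∣ ℚ.- ℚ.∣ q ∣ ℚ.≤ ℚ.∣ p ℚ.- q ∣
  ∣p∣-∣q∣≤∣p-q∣ p q = respʳ ℚ._≤_ (xyx⁻¹≈y ℚ.∣ q ∣ ℚ.∣ p ℚ.- q ∣)
    (ℚ.+-monoˡ-≤ (ℚ.- ℚ.∣ q ∣) (∣p∣≤∣q∣+∣p-q∣ p q))

  ∣∣p∣-∣q∣∣≤∣p-q∣ : ∀ p q → ℚ.∣ ℚ.∣ p ∣ ℚ.- ℚ.∣ q ∣ ∣ ℚ.≤ ℚ.∣ p ℚ.- q ∣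
  ∣∣p∣-∣q∣∣≤∣p-q∣ p q with ℚ.∣p∣≡p∨∣p∣≡-p (ℚ.∣ p ∣ ℚ.- ℚ.∣ q ∣)
  ... | inj₁ eq = respˡ ℚ._≤_ (sym eq) (∣p∣-∣q∣≤∣p-q∣ p q)
  ... | inj₂ eq = respˡ ℚ._≤_ (sym (trans eq (⁻¹-anti-homo-// ℚ.∣ p ∣ ℚ.∣ q ∣)))
                    (respʳ ℚ._≤_ (∣p-q∣≡∣q-p∣ q p) (∣p∣-∣q∣≤∣p-q∣ q p))

  ∣p*q∣<K*δ : ∀ {p q K δ} → 0ℚ ℚ.< K → ℚ.∣ p ∣ ℚ.≤ K → ℚ.∣ q ∣ ℚ.< δ →
    ℚ.∣ p ℚ.* q ∣ ℚ.< K ℚ.* δ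
  ∣p*q∣<K*δ {p} {q} {K} 0<K ∣p∣≤K ∣q∣<δ = respˡ ℚ._<_ (sym (ℚ.∣p*q∣≡∣p∣*∣q∣ p q))
    (ℚ.≤-<-trans
      (ℚ.*-monoʳ-≤-nonNeg ℚ.∣ q ∣ {{ℚ.∣-∣-nonNeg q}} ∣p∣≤K)
      (ℚ.*-monoʳ-<-pos K {{ℚ.positive 0<K}} ∣q∣<δ))

-- The real numbers as Cauchy sequences of rationals. They are identified by
-- the setoid equality _≃_ below; all operations are computed termwise.

Cauchy : (ℕ → ℚ) → Set
Cauchy s = ∀ ε → 0ℚ ℚ.< ε →
  ∃[ N ] ∀ m n → N ℕ.≤ m → N ℕ.≤ n → ℚ.∣ s m ℚ.- s n ∣ ℚ.< ε

record ℝ : Set where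
  constructor mkℝ
  field
    seq    : ℕ → ℚ
    cauchy : Cauchy seq

open ℝ public

infix 4 _≃_ _≤_ _≥_

_≃_ : ℝ → ℝ → Set
x ≃ y = ∀ ε → 0ℚ ℚ.< ε →
  ∃[ N ] ∀ n → N ℕ.≤ n → ℚ.∣ seq x n ℚ.- seq y n ∣ ℚ.< ε

-- The ε makes ≤ independent of the representing sequences: the termwise
-- inequality of two representatives need never hold, even for equal reals.
_≤_ : ℝ → ℝ → Set
x ≤ y = ∀ ε → 0ℚ ℚ.< ε →
  ∃[ N ] ∀ n → N ℕ.≤ n → seq x n ℚ.< seq y n ℚ.+ ε

_≥_ : ℝ → ℝ → Set
x ≥ y = y ≤ x

≃-refl : ∀ {x} → x ≃ x
≃-refl {x} ε 0<ε = 0 , λ n _ →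
  respˡ ℚ._<_ (sym (cong ℚ.∣_∣ (ℚ.+-inverseʳ (seq x n)))) 0<ε

≃-sym : ∀ {x y} → x ≃ y → y ≃ x
≃-sym {x} {y} x≃y ε 0<ε with x≃y ε 0<ε
... | N , h = N , λ n N≤n →
  respˡ ℚ._<_ (∣p-q∣≡∣q-p∣ (seq x n) (seq y n)) (h n N≤n)

≃-trans : ∀ {x y z} → x ≃ y → y ≃ z → x ≃ z
≃-trans {x} {y} {z} x≃y y≃z ε 0<ε
  with x≃y (½ ℚ.* ε) (0<½ε 0<ε) | y≃z (½ ℚ.* ε) (0<½ε 0<ε)
... | N₁ , h₁ | N₂ , h₂ = N₁ ℕ.⊔ N₂ , λ n N≤n →
  ≤+<½⇒< (∣p-r∣≤∣p-q∣+∣q-r∣ (seq x n) (seq y n) (seq z n))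
    (h₁ n (ℕ.m⊔n≤o⇒m≤o N₁ N₂ N≤n))
    (h₂ n (ℕ.m⊔n≤o⇒n≤o N₁ N₂ N≤n))

ℝ-setoid : Setoid 0ℓ 0ℓ
ℝ-setoid = record
  { Carrier       = ℝ
  ; _≈_           = _≃_
  ; isEquivalence = record
    { refl  = λ {x} → ≃-refl {x}
    ; sym   = λ {x} {y} → ≃-sym {x} {y}
    ; trans = λ {x} {y} {z} → ≃-trans {x} {y} {z}
    }
  }

infixl 6 _+_ _-_
infixl 7 _*_
infix  8 -_

fromℚ : ℚ → ℝ
fromℚ p = mkℝ (λ _ → p) λ ε 0<ε → 0 , λ _ _ _ _ →
  respˡ ℚ._<_ (sym (cong ℚ.∣_∣ (ℚ.+-inverseʳ p))) 0<ε

0ℝ 1ℝ : ℝ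
0ℝ = fromℚ 0ℚ
1ℝ = fromℚ 1ℚ

_+_ : ℝ → ℝ → ℝ
x + y = mkℝ (λ n → seq x n ℚ.+ seq y n) +-cauchy
  where
  lemma : ∀ p q r s → (p ℚ.- r) ℚ.+ (q ℚ.- s) ≡ (p ℚ.+ q) ℚ.- (r ℚ.+ s)
  lemma p q r s = trans (interchange p (ℚ.- r) q (ℚ.- s))
    (cong ((p ℚ.+ q) ℚ.+_) (sym (ℚ.neg-distrib-+ r s)))

  +-cauchy : Cauchy (λ n → seq x n ℚ.+ seq y n)
  +-cauchy ε 0<ε with cauchy x (½ ℚ.* ε) (0<½ε 0<ε) | cauchy y (½ ℚ.* ε) (0<½ε 0<ε)
  ... | N₁ , h₁ | N₂ , h₂ = N₁ ℕ.⊔ N₂ , λ m n N≤m N≤n →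
    ≤+<½⇒<
      (respˡ ℚ._≤_ (cong ℚ.∣_∣ (lemma (seq x m) (seq y m) (seq x n) (seq y n)))
        (ℚ.∣p+q∣≤∣p∣+∣q∣ (seq x m ℚ.- seq x n) (seq y m ℚ.- seq y n)))
      (h₁ m n (ℕ.m⊔n≤o⇒m≤o N₁ N₂ N≤m) (ℕ.m⊔n≤o⇒m≤o N₁ N₂ N≤n))
      (h₂ m n (ℕ.m⊔n≤o⇒n≤o N₁ N₂ N≤m) (ℕ.m⊔n≤o⇒n≤o N₁ N₂ N≤n))

-_ : ℝ → ℝ
- x = mkℝ (λ n → ℚ.- seq x n) neg-cauchy
  where
  neg-cauchy : Cauchy (λ n → ℚ.- seq x n)
  neg-cauchy ε 0<ε with cauchy x ε 0<ε
  ... | N , h = N , λ m n N≤m N≤n →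
    respˡ ℚ._<_
      (trans (sym (ℚ.∣-p∣≡∣p∣ (seq x m ℚ.- seq x n))) (cong ℚ.∣_∣ (ℚ.neg-distrib-+ (seq x m) (ℚ.- seq x n))))
      (h m n N≤m N≤n)

_-_ : ℝ → ℝ → ℝ
x - y = x + (- y)

∣_∣ : ℝ → ℝ
∣ x ∣ = mkℝ (λ n → ℚ.∣ seq x n ∣) abs-cauchy
  where
  abs-cauchy : Cauchy (λ n → ℚ.∣ seq x n ∣)
  abs-cauchy ε 0<ε with cauchy x ε 0<ε
  ... | N , h = N , λ m n N≤m N≤n →
    ℚ.≤-<-trans (∣∣p∣-∣q∣∣≤∣p-q∣ (seq x m) (seq x n)) (h m n N≤m N≤n)

eventually-bounded : ∀ x →
  ∃[ K ] 0ℚ ℚ.< K × ∃[ N ] ∀ n → N ℕ.≤ n → ℚ.∣ seq x n ∣ ℚ.≤ K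
eventually-bounded x with cauchy x 1ℚ (ℚ.positive⁻¹ 1ℚ)
... | N , h = ℚ.∣ seq x N ∣ ℚ.+ 1ℚ
            , ℚ.+-mono-≤-< (ℚ.0≤∣p∣ (seq x N)) (ℚ.positive⁻¹ 1ℚ)
            , N
            , λ n N≤n → ℚ.≤-trans (∣p∣≤∣q∣+∣p-q∣ (seq x n) (seq x N))
                (ℚ.+-monoʳ-≤ ℚ.∣ seq x N ∣ (ℚ.<⇒≤ (h n N N≤n ℕ.≤-refl)))

_*_ : ℝ → ℝ → ℝ
x * y = mkℝ (λ n → seq x n ℚ.* seq y n) *-cauchy
  where
  lemma : ∀ p q r s →
    p ℚ.* (q ℚ.- s) ℚ.+ s ℚ.* (p ℚ.- r) ≡ p ℚ.* q ℚ.- r ℚ.* s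
  lemma p q r s = trans
    (cong₂ ℚ._+_
      (trans (ℚ.*-distribˡ-+ p q (ℚ.- s)) (cong (p ℚ.* q ℚ.+_) (sym (ℚ.neg-distribʳ-* p s))))
      (trans (ℚ.*-distribˡ-+ s p (ℚ.- r))
        (cong₂ ℚ._+_ (ℚ.*-comm s p)
          (trans (sym (ℚ.neg-distribʳ-* s r)) (cong ℚ.-_ (ℚ.*-comm s r))))))
    (telescope (p ℚ.* q) (p ℚ.* s) (r ℚ.* s))

  *-cauchy : Cauchy (λ n → seq x n ℚ.* seq y n)
  *-cauchy ε 0<ε =
    let K₁ , 0<K₁ , M₁ , b₁ = eventually-bounded x
        K₂ , 0<K₂ , M₂ , b₂ = eventually-bounded y
        δ₁ , 0<δ₁ , K₁δ₁≡½ε = divide 0<K₁ (0<½ε 0<ε)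
        δ₂ , 0<δ₂ , K₂δ₂≡½ε = divide 0<K₂ (0<½ε 0<ε)
        N₁ , h₁ = cauchy y δ₁ 0<δ₁
        N₂ , h₂ = cauchy x δ₂ 0<δ₂
        M = M₁ ℕ.⊔ M₂
        N = N₁ ℕ.⊔ N₂
    in M ℕ.⊔ N , λ m n ≤m ≤n →
    let M≤m = ℕ.m⊔n≤o⇒m≤o M N ≤m
        M≤n = ℕ.m⊔n≤o⇒m≤o M N ≤n
        N≤m = ℕ.m⊔n≤o⇒n≤o M N ≤m
        N≤n = ℕ.m⊔n≤o⇒n≤o M N ≤n
    in ≤+<½⇒<
      (respˡ ℚ._≤_ (cong ℚ.∣_∣ (lemma (seq x m) (seq y m) (seq x n) (seq y n)))
        (ℚ.∣p+q∣≤∣p∣+∣q∣ (seq x m ℚ.* (seq y m ℚ.- seq y n))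
                          (seq y n ℚ.* (seq x m ℚ.- seq x n))))
      (respʳ ℚ._<_ K₁δ₁≡½ε
        (∣p*q∣<K*δ {p = seq x m} {q = seq y m ℚ.- seq y n} 0<K₁
          (b₁ m (ℕ.m⊔n≤o⇒m≤o M₁ M₂ M≤m))
          (h₁ m n (ℕ.m⊔n≤o⇒m≤o N₁ N₂ N≤m) (ℕ.m⊔n≤o⇒m≤o N₁ N₂ N≤n))))
      (respʳ ℚ._<_ K₂δ₂≡½ε
        (∣p*q∣<K*δ {p = seq y n} {q = seq x m ℚ.- seq x n} 0<K₂
          (b₂ n (ℕ.m⊔n≤o⇒n≤o M₁ M₂ M≤n))
          (h₂ m n (ℕ.m⊔n≤o⇒n≤o N₁ N₂ N≤m) (ℕ.m⊔n≤o⇒n≤o N₁ N₂ N≤n))))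

+-rawMonoid : RawMonoid 0ℓ 0ℓ
+-rawMonoid = record { Carrier = ℝ ; _≈_ = _≃_ ; _∙_ = _+_ ; ε = 0ℝ }

*-rawMonoid : RawMonoid 0ℓ 0ℓ
*-rawMonoid = record { Carrier = ℝ ; _≈_ = _≃_ ; _∙_ = _*_ ; ε = 1ℝ }

open RawMonoidDefinitions +-rawMonoid public using (sum)
open RawMonoidDefinitions *-rawMonoid public using () renaming (sum to product)

-- Func carries congruence for _≃_, so these are the functions on the reals
-- themselves rather than on representing sequences.
RealFunction : Set
RealFunction = Func ℝ-setoid ℝ-setoid

module _ (f : RealFunction) where

  open Func f using () renaming (to to g)

  Even : Set
  Even = ∀ x → g (- x) ≃ g x

  Odd : Set
  Odd = ∀ x → g (- x) ≃ - g x

  Monotone≥0 : Set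
  Monotone≥0 = ∀ x y → 0ℝ ≤ x → x ≤ y → g x ≤ g y

  ProductInequality : Set
  ProductInequality = ∀ x y z → x ≥ y → y ≥ 0ℝ → z ≥ 0ℝ →
    g x * g (y + z) ≥ g y * g (x + z)

  SumInequality : Set
  SumInequality = ∀ x y z → x ≥ y → y ≥ 0ℝ → z ≥ 0ℝ →
    g x + g (y + z) ≤ g y + g (x + z)

  𝒢 : Set
  𝒢 = (Even ⊎ Odd) × g 0ℝ ≥ 0ℝ × Monotone≥0

  𝒢₂ : Set
  𝒢₂ = 𝒢 × ProductInequality × SumInequality

{-# OPTIONS --safe #-}
module Submission where

-- Write Gᵢⱼ = g (xᵢ − xⱼ) and let g (−x) = σ g x with σ = ±1. Then the i-th
-- product is σⁱ Pᵢ (i counted from 0), where Pᵢ involves only Gⱼₖ with j < k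
-- and so is nonnegative, and the sign σ preserves the bounds ∣a₁∣, ∣a₃∣, ∣a₅∣.
-- With b₁ = ∣a₁∣ and b₃ = ∣a₃∣ the sum equals
--   (a₀ − b₁) P₀ + (b₁ + σ a₁) P₁ + (a₂ − b₃) P₂ + (b₃ + σ a₃) P₃ + (a₄ + σ a₅) P₅
--     + (b₁ − a₄) (P₀ − P₁) + a₄ (P₀ + P₄ − P₅ − P₁) + b₃ (P₂ − P₃),
-- so it suffices that P₁ ≤ P₀ (monotonicity), P₃ ≤ P₂ (two instances of the
-- product inequality) and P₅ + P₁ ≤ P₀ + P₄. For the last, G₁₄ ≤ G₀₅, G₄₅ ≤ G₀₁
-- and G₁₅ ≤ G₀₄ reduce it to
--   G₁₂ G₁₃ + G₃₅ G₂₅ ≤ G₀₂ G₀₃ + G₃₄ G₂₄,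
-- and this follows from the sum inequality applied to G₁ⱼ, Gₖ₅, G₀ⱼ, Gₖ₄ for {j,k} = {2,3}.

open import Algebra.Bundles using (CommutativeRing)
import Algebra.Definitions.RawMonoid as RawMonoidDefinitions
import Algebra.Properties.Ring as RingProperties
import Algebra.Solver.Ring as RingSolver
open import Algebra.Solver.Ring.AlmostCommutativeRing
  using (fromCommutativeRing; _-Raw-AlmostCommutative⟶_)
open import Data.Fin.Base using (Fin)
open import Data.Fin.Patterns using (0F; 1F; 2F; 3F; 4F; 5F)
import Data.Maybe.Base as Maybe
open import Data.Nat as ℕ using (ℕ)
import Data.Nat.Properties as ℕ
open import Data.Product using (_×_; _,_; ∃-syntax)
open import Data.Rational as ℚ using (ℚ; 0ℚ; ½)
import Data.Rational.Properties as ℚ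
import Data.Rational.Solver as ℚ
open import Data.Sum using (_⊎_; inj₁; inj₂)
open import Data.Vec.Functional using (Vector; removeAt)
open import Function.Bundles using (Func)
open import Level using (0ℓ; suc; _⊔_)
open import Relation.Binary.Bundles using (Preorder; Setoid)
import Relation.Binary.Reasoning.Preorder as PreorderReasoning
open import Relation.Binary.PropositionalEquality as ≡ using (_≡_)
open import Relation.Binary.Structures using (IsPreorder)
open import Relation.Nullary.Decidable using (dec⇒maybe)

-- The rationals serve only as coefficients for the ring solver, which needs
-- decidable coefficients to recognise cancellations.
record OrderedℚAlgebra c ℓ₁ ℓ₂ : Set (suc (c ⊔ ℓ₁ ⊔ ℓ₂)) where
  infix 4 _≤_
  field
    commutativeRing : CommutativeRing c ℓ₁
  open CommutativeRing commutativeRing public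
  field
    embedding  : CommutativeRing.rawRing ℚ.+-*-commutativeRing
                   -Raw-AlmostCommutative⟶ fromCommutativeRing commutativeRing
    _≤_        : Carrier → Carrier → Set ℓ₂
    isPreorder : IsPreorder _≈_ _≤_
    +-monoˡ-≤  : ∀ z {x y} → x ≤ y → x + z ≤ y + z
    0≤*0≤⇒0≤   : ∀ {x y} → 0# ≤ x → 0# ≤ y → 0# ≤ x * y

-- Inequalities in an ordered commutative algebra over the rationals.

module OrderedAlgebraProperties {c ℓ₁ ℓ₂} (A : OrderedℚAlgebra c ℓ₁ ℓ₂) where

  open OrderedℚAlgebra A
  open IsPreorder isPreorder public using () renaming
    (refl to ≤-refl; reflexive to ≤-reflexive; trans to ≤-trans)

  module Solver = RingSolver (CommutativeRing.rawRing ℚ.+-*-commutativeRing)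
    (fromCommutativeRing commutativeRing) embedding
    (λ p q → Maybe.map (λ p≡q → reflexive (≡.cong (_-Raw-AlmostCommutative⟶_.⟦_⟧ embedding) p≡q))
      (dec⇒maybe (p ℚ.≟ q)))
  open Solver using (solve; _:+_; _:*_; _:-_; :-_; _:=_)

  ≤-preorder : Preorder c ℓ₁ ℓ₂
  ≤-preorder = record { isPreorder = isPreorder }

  module ≤-Reasoning = PreorderReasoning ≤-preorder
  open RingProperties ring using (-1*x≈-x; -‿involutive)

  +-mono-≤ : ∀ {x y u v} → x ≤ y → u ≤ v → x + u ≤ y + v
  +-mono-≤ {x} {y} {u} {v} x≤y u≤v = begin
    x + u  ≲⟨ +-monoˡ-≤ u x≤y ⟩
    y + u  ≈⟨ +-comm y u ⟩
    u + y  ≲⟨ +-monoˡ-≤ y u≤v ⟩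
    v + y  ≈⟨ +-comm v y ⟩
    y + v  ∎
    where open ≤-Reasoning

  0≤+0≤⇒0≤ : ∀ {x y} → 0# ≤ x → 0# ≤ y → 0# ≤ x + y
  0≤+0≤⇒0≤ 0≤x 0≤y = ≤-trans (≤-reflexive (sym (+-identityˡ 0#))) (+-mono-≤ 0≤x 0≤y)

  x≤y⇒0≤y-x : ∀ {x y} → x ≤ y → 0# ≤ y - x
  x≤y⇒0≤y-x {x} {y} x≤y = ≤-trans (≤-reflexive (sym (-‿inverseʳ x))) (+-monoˡ-≤ (- x) x≤y)

  0≤y-x⇒x≤y : ∀ {x y} → 0# ≤ y - x → x ≤ y
  0≤y-x⇒x≤y {x} {y} 0≤y-x = begin
    x          ≈⟨ +-identityˡ x ⟨
    0# + x     ≲⟨ +-monoˡ-≤ x 0≤y-x ⟩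
    y - x + x  ≈⟨ solve 2 (λ x y → y :- x :+ x := y) refl x y ⟩
    y          ∎
    where open ≤-Reasoning

  -- Linear rearrangements of an inequality reduce to one ring identity between the two differences,
  -- which the solver can check.
  ≤-shift : ∀ {u v x y} → v - u ≈ y - x → u ≤ v → x ≤ y
  ≤-shift v-u≈y-x u≤v = 0≤y-x⇒x≤y (≤-trans (x≤y⇒0≤y-x u≤v) (≤-reflexive v-u≈y-x))

  x+y≤u+v⇒x-v≤u-y : ∀ {x y u v} → x + y ≤ u + v → x - v ≤ u - y
  x+y≤u+v⇒x-v≤u-y {x} {y} {u} {v} = ≤-shift
    (solve 4 (λ x y u v → (u :+ v) :- (x :+ y) := (u :- y) :- (x :- v)) refl x y u v)

  -- The difference of the products is `(y - x) * v + x * (v - u)`, so the signs asked for are those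
  -- of `x` and `v`.
  *-mono-≤ : ∀ {x y u v} → 0# ≤ x → 0# ≤ v → x ≤ y → u ≤ v → x * u ≤ y * v
  *-mono-≤ {x} {y} {u} {v} 0≤x 0≤v x≤y u≤v = 0≤y-x⇒x≤y (≤-trans
    (0≤+0≤⇒0≤ (0≤*0≤⇒0≤ (x≤y⇒0≤y-x x≤y) 0≤v) (0≤*0≤⇒0≤ 0≤x (x≤y⇒0≤y-x u≤v)))
    (≤-reflexive (solve 4 (λ x y u v → (y :- x) :* v :+ x :* (v :- u) := y :* v :- x :* u)
      refl x y u v)))

  -- Think of `a`, `b`, `c`, `d` as values at the top, the two middle points and the bottom of a
  -- four-point lattice. As with products of nonnegative monotone supermodular functions, the
  -- difference is a sum of four products of nonnegative factors, displayed in the solver call.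
  supermodular-* : ∀ {a a′ b b′ c c′ d d′} → 0# ≤ a′ → 0# ≤ d →
    d ≤ b → d ≤ c → b′ ≤ a′ → c′ ≤ a′ → b + c ≤ a + d → b′ + c′ ≤ a′ + d′ →
    b * b′ + c * c′ ≤ a * a′ + d * d′
  supermodular-* {a} {a′} {b} {b′} {c} {c′} {d} {d′}
    0≤a′ 0≤d d≤b d≤c b′≤a′ c′≤a′ b+c≤a+d b′+c′≤a′+d′ = 0≤y-x⇒x≤y (≤-trans
    (0≤+0≤⇒0≤ (0≤+0≤⇒0≤ (0≤+0≤⇒0≤
      (0≤*0≤⇒0≤ (x≤y⇒0≤y-x b+c≤a+d) 0≤a′)
      (0≤*0≤⇒0≤ (x≤y⇒0≤y-x d≤c) (x≤y⇒0≤y-x c′≤a′)))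
      (0≤*0≤⇒0≤ (x≤y⇒0≤y-x d≤b) (x≤y⇒0≤y-x b′≤a′)))
      (0≤*0≤⇒0≤ 0≤d (x≤y⇒0≤y-x b′+c′≤a′+d′)))
    (≤-reflexive (solve 8 (λ a a′ b b′ c c′ d d′ →
      (a :+ d :- (b :+ c)) :* a′ :+ (c :- d) :* (a′ :- c′)
        :+ (b :- d) :* (a′ :- b′) :+ d :* (a′ :+ d′ :- (b′ :+ c′))
      := a :* a′ :+ d :* d′ :- (b :* b′ :+ c :* c′))
      refl a a′ b b′ c c′ d d′)))

  -- Abel summation: the difference is `(w - z) * (y - x) + z * (y + v - (x + u))`. The larger
  -- weight sits on the pair known to be ordered; the other pair enters only through the sum.
  weighted-≤ : ∀ {w z x y} → 0# ≤ z → z ≤ w → x ≤ y →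
    ∀ {u v} → x + u ≤ y + v → w * x + z * u ≤ w * y + z * v
  weighted-≤ {w} {z} {x} {y} 0≤z z≤w x≤y {u} {v} x+u≤y+v = 0≤y-x⇒x≤y (≤-trans
    (0≤+0≤⇒0≤ (0≤*0≤⇒0≤ (x≤y⇒0≤y-x z≤w) (x≤y⇒0≤y-x x≤y)) (0≤*0≤⇒0≤ 0≤z (x≤y⇒0≤y-x x+u≤y+v)))
    (≤-reflexive (solve 6 (λ w z x y u v →
      (w :- z) :* (y :- x) :+ z :* (y :+ v :- (x :+ u))
      := w :* y :+ z :* v :- (w :* x :+ z :* u)) refl w z x y u v)))

  -- Parity as a ring element: even and odd functions both satisfy g (-x) = σ g x, so one
  -- computation serves both.
  Sign : Carrier → Set ℓ₁
  Sign σ = σ ≈ 1# ⊎ σ ≈ - 1#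

  Sign⇒σ*σ≈1 : ∀ {σ} → Sign σ → σ * σ ≈ 1#
  Sign⇒σ*σ≈1 (inj₁ σ≈1)  = trans (*-cong σ≈1 σ≈1) (*-identityˡ 1#)
  Sign⇒σ*σ≈1 (inj₂ σ≈-1) = trans (*-cong σ≈-1 σ≈-1) (trans (-1*x≈-x (- 1#)) (-‿involutive 1#))

  -- The two bounds together say that the absolute value of `x` is at most `y`, phrased without an
  -- absolute value, which the abstract algebra does not carry.
  Sign⇒0≤y+σ*x : ∀ {σ x y} → Sign σ → x ≤ y → - x ≤ y → 0# ≤ y + σ * x
  Sign⇒0≤y+σ*x {x = x} (inj₁ σ≈1) _ -x≤y = ≤-trans (x≤y⇒0≤y-x -x≤y) (≤-reflexive
    (+-congˡ (trans (-‿involutive x) (sym (trans (*-congʳ σ≈1) (*-identityˡ x))))))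
  Sign⇒0≤y+σ*x {x = x} (inj₂ σ≈-1) x≤y _ = ≤-trans (x≤y⇒0≤y-x x≤y) (≤-reflexive
    (+-congˡ (sym (trans (*-congʳ σ≈-1) (-1*x≈-x x)))))

  -- The six-point inequality over an abstract ordered algebra.

  module _ (g : Carrier → Carrier)
    (g-cong : ∀ {x y} → x ≈ y → g x ≈ g y)
    {σ : Carrier} (σ-sign : Sign σ)
    (g-parity : ∀ x → g (- x) ≈ σ * g x)
    (0≤g0 : 0# ≤ g 0#)
    (g-mono : ∀ x y → 0# ≤ x → x ≤ y → g x ≤ g y)
    (g-product : ∀ x y z → y ≤ x → 0# ≤ y → 0# ≤ z → g y * g (x + z) ≤ g x * g (y + z))
    (g-sum : ∀ x y z → y ≤ x → 0# ≤ y → 0# ≤ z → g x + g (y + z) ≤ g y + g (x + z))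
    (x : Vector Carrier 6)
    (x₁≤x₀ : x 1F ≤ x 0F) (x₂≤x₁ : x 2F ≤ x 1F) (x₃≤x₂ : x 3F ≤ x 2F)
    (x₄≤x₃ : x 4F ≤ x 3F) (x₅≤x₄ : x 5F ≤ x 4F)
    (x₁+x₄≤x₀+x₅ : x 1F + x 4F ≤ x 0F + x 5F)
    (x₂+x₃≤x₁+x₄ : x 2F + x 3F ≤ x 1F + x 4F)
    where

    open RawMonoidDefinitions +-rawMonoid using (sum)
    open RawMonoidDefinitions *-rawMonoid using () renaming (sum to product)

    private
      G : Fin 6 → Fin 6 → Carrier
      G i j = g (x i - x j)

      x₂≤x₀ = ≤-trans x₂≤x₁ x₁≤x₀
      x₃≤x₀ = ≤-trans x₃≤x₂ x₂≤x₀
      x₄≤x₀ = ≤-trans x₄≤x₃ x₃≤x₀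
      x₅≤x₀ = ≤-trans x₅≤x₄ x₄≤x₀
      x₃≤x₁ = ≤-trans x₃≤x₂ x₂≤x₁
      x₄≤x₁ = ≤-trans x₄≤x₃ x₃≤x₁
      x₅≤x₁ = ≤-trans x₅≤x₄ x₄≤x₁
      x₄≤x₂ = ≤-trans x₄≤x₃ x₃≤x₂
      x₅≤x₂ = ≤-trans x₅≤x₄ x₄≤x₂
      x₅≤x₃ = ≤-trans x₅≤x₄ x₄≤x₃
      x₂+x₃≤x₀+x₅ = ≤-trans x₂+x₃≤x₁+x₄ x₁+x₄≤x₀+x₅

      0≤G : ∀ {i j} → x j ≤ x i → 0# ≤ G i j
      0≤G {i} {j} xⱼ≤xᵢ = ≤-trans 0≤g0 (g-mono 0# (x i - x j) ≤-refl (x≤y⇒0≤y-x xⱼ≤xᵢ))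

      -- Differences are compared in the additive form of the hypotheses on the points, so that
      -- those apply directly.
      G-mono : ∀ {i j k l} → x j ≤ x i → x i + x l ≤ x k + x j → G i j ≤ G k l
      G-mono {i} {j} {k} {l} xⱼ≤xᵢ xᵢ+xₗ≤xₖ+xⱼ =
        g-mono (x i - x j) (x k - x l) (x≤y⇒0≤y-x xⱼ≤xᵢ) (x+y≤u+v⇒x-v≤u-y xᵢ+xₗ≤xₖ+xⱼ)

      G-monoˡ : ∀ {i j k} → x j ≤ x i → x i ≤ x k → G i j ≤ G k j
      G-monoˡ {j = j} xⱼ≤xᵢ xᵢ≤xₖ = G-mono xⱼ≤xᵢ (+-monoˡ-≤ (x j) xᵢ≤xₖ)

      G-monoʳ : ∀ {i j l} → x j ≤ x i → x l ≤ x j → G i j ≤ G i l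
      G-monoʳ {i} xⱼ≤xᵢ xₗ≤xⱼ = G-mono xⱼ≤xᵢ (+-mono-≤ ≤-refl xₗ≤xⱼ)

      telescope : ∀ i j k → x i - x j + (x j - x k) ≈ x i - x k
      telescope i j k = solve 3 (λ p q r → p :- q :+ (q :- r) := p :- r) refl (x i) (x j) (x k)

      -- The product inequality at xᵢ - xⱼ, xₖ - xₗ and the shift xⱼ - xₖ: the shift telescopes with
      -- either argument.
      G-product : ∀ {i j k l} → x k ≤ x j → x l ≤ x k → x j + x k ≤ x i + x l →
        G k l * G i k ≤ G i j * G j l
      G-product {i} {j} {k} {l} xₖ≤xⱼ xₗ≤xₖ xⱼ+xₖ≤xᵢ+xₗ = begin
        G k l * G i k                            ≈⟨ *-congˡ (g-cong (telescope i j k)) ⟨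
        G k l * g (x i - x j + (x j - x k))      ≲⟨ g-product (x i - x j) (x k - x l) (x j - x k)
          (x+y≤u+v⇒x-v≤u-y (≤-trans (≤-reflexive (+-comm (x k) (x j))) xⱼ+xₖ≤xᵢ+xₗ))
          (x≤y⇒0≤y-x xₗ≤xₖ) (x≤y⇒0≤y-x xₖ≤xⱼ) ⟩
        G i j * g (x k - x l + (x j - x k))      ≈⟨ *-congˡ (g-cong (trans (+-comm _ _) (telescope j k l))) ⟩
        G i j * G j l                            ∎
        where open ≤-Reasoning

      -- The sum inequality at x₁ - xⱼ, xₖ - x₄ and the shift x₄ - x₅, followed by monotonicity.
      G-sum : ∀ {j k} → x 4F ≤ x k → x j + x k ≤ x 1F + x 4F →
        G 1F j + G k 5F ≤ G 0F j + G k 4F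
      G-sum {j} {k} x₄≤xₖ xⱼ+xₖ≤x₁+x₄ = begin
        G 1F j + G k 5F                              ≈⟨ +-congˡ (g-cong (telescope k 4F 5F)) ⟨
        G 1F j + g (x k - x 4F + (x 4F - x 5F))      ≲⟨ g-sum (x 1F - x j) (x k - x 4F) (x 4F - x 5F)
          xₖ-x₄≤x₁-xⱼ 0≤xₖ-x₄ 0≤x₄-x₅ ⟩
        -- The shifted argument x₁ - xⱼ + x₄ - x₅ is at most x₀ - xⱼ because x₁ + x₄ ≤ x₀ + x₅.
        G k 4F + g (x 1F - x j + (x 4F - x 5F))      ≲⟨ +-mono-≤ ≤-refl (g-mono _ _
          (0≤+0≤⇒0≤ (≤-trans 0≤xₖ-x₄ xₖ-x₄≤x₁-xⱼ) 0≤x₄-x₅)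
          (≤-shift (solve 5 (λ p q r s t → (p :+ q) :- (r :+ s) := (p :- t) :- (r :- t :+ (s :- q)))
            refl (x 0F) (x 5F) (x 1F) (x 4F) (x j)) x₁+x₄≤x₀+x₅)) ⟩
        G k 4F + G 0F j                              ≈⟨ +-comm (G k 4F) (G 0F j) ⟩
        G 0F j + G k 4F                              ∎
        where
        open ≤-Reasoning
        0≤xₖ-x₄ = x≤y⇒0≤y-x x₄≤xₖ
        0≤x₄-x₅ = x≤y⇒0≤y-x x₅≤x₄
        xₖ-x₄≤x₁-xⱼ = x+y≤u+v⇒x-v≤u-y (≤-trans (≤-reflexive (+-comm (x k) (x j))) xⱼ+xₖ≤x₁+x₄)

      -- The factors stand in the order in which `removeAt` lists them, so passing from `row` to `P`
      -- only moves signs.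
      P : Fin 6 → Carrier
      P 0F = G 0F 1F * (G 0F 2F * (G 0F 3F * (G 0F 4F * G 0F 5F)))
      P 1F = G 0F 1F * (G 1F 2F * (G 1F 3F * (G 1F 4F * G 1F 5F)))
      P 2F = G 0F 2F * (G 1F 2F * (G 2F 3F * (G 2F 4F * G 2F 5F)))
      P 3F = G 0F 3F * (G 1F 3F * (G 2F 3F * (G 3F 4F * G 3F 5F)))
      P 4F = G 0F 4F * (G 1F 4F * (G 2F 4F * (G 3F 4F * G 4F 5F)))
      P 5F = G 0F 5F * (G 1F 5F * (G 2F 5F * (G 3F 5F * G 4F 5F)))

      infixr 7 _·_
      _·_ : ∀ {u v} → 0# ≤ u → 0# ≤ v → 0# ≤ u * v
      _·_ = 0≤*0≤⇒0≤

      0≤P : ∀ i → 0# ≤ P i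
      0≤P 0F = 0≤G x₁≤x₀ · 0≤G x₂≤x₀ · 0≤G x₃≤x₀ · 0≤G x₄≤x₀ · 0≤G x₅≤x₀
      0≤P 1F = 0≤G x₁≤x₀ · 0≤G x₂≤x₁ · 0≤G x₃≤x₁ · 0≤G x₄≤x₁ · 0≤G x₅≤x₁
      0≤P 2F = 0≤G x₂≤x₀ · 0≤G x₂≤x₁ · 0≤G x₃≤x₂ · 0≤G x₄≤x₂ · 0≤G x₅≤x₂
      0≤P 3F = 0≤G x₃≤x₀ · 0≤G x₃≤x₁ · 0≤G x₃≤x₂ · 0≤G x₄≤x₃ · 0≤G x₅≤x₃
      0≤P 4F = 0≤G x₄≤x₀ · 0≤G x₄≤x₁ · 0≤G x₄≤x₂ · 0≤G x₄≤x₃ · 0≤G x₅≤x₄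
      0≤P 5F = 0≤G x₅≤x₀ · 0≤G x₅≤x₁ · 0≤G x₅≤x₂ · 0≤G x₅≤x₃ · 0≤G x₅≤x₄

      -- The factor G₀₁ is common, and each of the others grows when x₁ is replaced by x₀.
      P₁≤P₀ : P 1F ≤ P 0F
      P₁≤P₀ =
        *-mono-≤ (0≤G x₁≤x₀) (0≤G x₂≤x₀ · 0≤G x₃≤x₀ · 0≤G x₄≤x₀ · 0≤G x₅≤x₀) ≤-refl
        (*-mono-≤ (0≤G x₂≤x₁) (0≤G x₃≤x₀ · 0≤G x₄≤x₀ · 0≤G x₅≤x₀) (G-monoˡ x₂≤x₁ x₁≤x₀)
        (*-mono-≤ (0≤G x₃≤x₁) (0≤G x₄≤x₀ · 0≤G x₅≤x₀) (G-monoˡ x₃≤x₁ x₁≤x₀)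
        (*-mono-≤ (0≤G x₄≤x₁) (0≤G x₅≤x₀) (G-monoˡ x₄≤x₁ x₁≤x₀) (G-monoˡ x₅≤x₁ x₁≤x₀))))

      -- Apart from the common factor G₂₃, the factors pair up by the outer points: x₀, x₅ give one
      -- instance of `G-product` and x₁, x₄ the other.
      P₃≤P₂ : P 3F ≤ P 2F
      P₃≤P₂ = begin
        P 3F
          ≈⟨ solve 5 (λ a b c d e → a :* (b :* (c :* (d :* e))) := c :* ((e :* a) :* (d :* b))) refl
               (G 0F 3F) (G 1F 3F) (G 2F 3F) (G 3F 4F) (G 3F 5F) ⟩
        G 2F 3F * ((G 3F 5F * G 0F 3F) * (G 3F 4F * G 1F 3F))
          ≲⟨ *-mono-≤ (0≤G x₃≤x₂) ((0≤G x₂≤x₀ · 0≤G x₅≤x₂) · (0≤G x₂≤x₁ · 0≤G x₄≤x₂)) ≤-refl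
               (*-mono-≤ (0≤G x₅≤x₃ · 0≤G x₃≤x₀) (0≤G x₂≤x₁ · 0≤G x₄≤x₂)
                 (G-product x₃≤x₂ x₅≤x₃ x₂+x₃≤x₀+x₅) (G-product x₃≤x₂ x₄≤x₃ x₂+x₃≤x₁+x₄)) ⟩
        G 2F 3F * ((G 0F 2F * G 2F 5F) * (G 1F 2F * G 2F 4F))
          ≈⟨ solve 5 (λ a b c d e → c :* ((a :* e) :* (b :* d)) := a :* (b :* (c :* (d :* e)))) refl
               (G 0F 2F) (G 1F 2F) (G 2F 3F) (G 2F 4F) (G 2F 5F) ⟩
        P 2F ∎
        where open ≤-Reasoning

      -- Weights are stripped in two rounds of `weighted-≤`: first G₁₄ ≤ G₀₅, pairing P₅ with P₀ and
      -- P₁ with P₄, then G₄₅ ≤ G₀₁ in `step`. Last, G₁₅ ≤ G₀₄ leaves the inequality between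
      -- products of two factors.
      P₅+P₁≤P₀+P₄ : P 5F + P 1F ≤ P 0F + P 4F
      P₅+P₁≤P₀+P₄ = begin
        P 5F + P 1F
          ≈⟨ solve 9 (λ p q a d c b b′ e e′ →
               p :* (c :* (e′ :* (e :* d))) :+ a :* (b :* (b′ :* (q :* c)))
               := p :* (d :* (c :* (e :* e′))) :+ q :* (a :* (c :* (b :* b′)))) refl
               (G 0F 5F) (G 1F 4F) (G 0F 1F) (G 4F 5F) (G 1F 5F)
               (G 1F 2F) (G 1F 3F) (G 3F 5F) (G 2F 5F) ⟩
        G 0F 5F * (G 4F 5F * (G 1F 5F * CC′)) + G 1F 4F * (G 0F 1F * (G 1F 5F * BB′))
          ≲⟨ weighted-≤ (0≤G x₄≤x₁) (G-mono x₄≤x₁ (+-mono-≤ x₁≤x₀ x₅≤x₄))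
               (*-mono-≤ (0≤G x₅≤x₄) (0≤G x₄≤x₀ · 0≤AA′) G₄₅≤G₀₁
                 (*-mono-≤ (0≤G x₅≤x₁) 0≤AA′ G₁₅≤G₀₄ CC′≤AA′))
               step ⟩
        G 0F 5F * (G 0F 1F * (G 0F 4F * AA′)) + G 1F 4F * (G 4F 5F * (G 0F 4F * DD′))
          ≈⟨ solve 9 (λ p q a d b a₁ a₂ e e′ →
               p :* (a :* (b :* (a₁ :* a₂))) :+ q :* (d :* (b :* (e :* e′)))
               := a :* (a₁ :* (a₂ :* (b :* p))) :+ b :* (q :* (e′ :* (e :* d)))) refl
               (G 0F 5F) (G 1F 4F) (G 0F 1F) (G 4F 5F) (G 0F 4F)
               (G 0F 2F) (G 0F 3F) (G 3F 4F) (G 2F 4F) ⟩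
        P 0F + P 4F ∎
        where
        open ≤-Reasoning
        AA′ = G 0F 2F * G 0F 3F
        BB′ = G 1F 2F * G 1F 3F
        CC′ = G 3F 5F * G 2F 5F
        DD′ = G 3F 4F * G 2F 4F

        0≤AA′ = 0≤G x₂≤x₀ · 0≤G x₃≤x₀
        G₄₅≤G₀₁ = G-mono x₅≤x₄ (≤-trans (≤-reflexive (+-comm (x 4F) (x 1F))) x₁+x₄≤x₀+x₅)
        G₁₅≤G₀₄ = G-mono x₅≤x₁ x₁+x₄≤x₀+x₅
        G₃₅≤G₀₂ = G-mono x₅≤x₃ (≤-trans (≤-reflexive (+-comm (x 3F) (x 2F))) x₂+x₃≤x₀+x₅)
        G₂₅≤G₀₃ = G-mono x₅≤x₂ x₂+x₃≤x₀+x₅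
        G₃₄≤G₁₂ = G-mono x₄≤x₃ (≤-trans (≤-reflexive (+-comm (x 3F) (x 2F))) x₂+x₃≤x₁+x₄)

        BB′≤AA′ = *-mono-≤ (0≤G x₂≤x₁) (0≤G x₃≤x₀) (G-monoˡ x₂≤x₁ x₁≤x₀) (G-monoˡ x₃≤x₁ x₁≤x₀)
        CC′≤AA′ = *-mono-≤ (0≤G x₅≤x₃) (0≤G x₃≤x₀) G₃₅≤G₀₂ G₂₅≤G₀₃

        -- The top values are G₀₂ and G₀₃, the bottom ones G₃₄ and G₂₄. The two uses of `G-sum` take
        -- (j, k) = (2, 3) and (3, 2).
        BB′+CC′≤AA′+DD′ = supermodular-* (0≤G x₃≤x₀) (0≤G x₄≤x₃)
          G₃₄≤G₁₂ (G-monoʳ x₄≤x₃ x₅≤x₄) (G-monoˡ x₃≤x₁ x₁≤x₀) G₂₅≤G₀₃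
          (G-sum x₄≤x₃ x₂+x₃≤x₁+x₄)
          (G-sum x₄≤x₂ (≤-trans (≤-reflexive (+-comm (x 3F) (x 2F))) x₂+x₃≤x₁+x₄))

        step : G 4F 5F * (G 1F 5F * CC′) + G 0F 1F * (G 1F 5F * BB′)
             ≤ G 0F 1F * (G 0F 4F * AA′) + G 4F 5F * (G 0F 4F * DD′)
        step = begin
          G 4F 5F * (G 1F 5F * CC′) + G 0F 1F * (G 1F 5F * BB′)
            ≈⟨ +-comm _ _ ⟩
          G 0F 1F * (G 1F 5F * BB′) + G 4F 5F * (G 1F 5F * CC′)
            -- The pairing changes here: `BB′` is matched with `AA′` under the larger weight, and
            -- `CC′` with `DD′`.
            ≲⟨ weighted-≤ (0≤G x₅≤x₄) G₄₅≤G₀₁ (*-mono-≤ (0≤G x₅≤x₁) 0≤AA′ G₁₅≤G₀₄ BB′≤AA′)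
                 (≤-trans (≤-reflexive (sym (distribˡ _ _ _)))
                 (≤-trans (*-mono-≤ (0≤G x₅≤x₁) (0≤+0≤⇒0≤ 0≤AA′ (0≤G x₄≤x₃ · 0≤G x₄≤x₂))
                   G₁₅≤G₀₄ BB′+CC′≤AA′+DD′)
                 (≤-reflexive (distribˡ _ _ _)))) ⟩
          G 0F 1F * (G 0F 4F * AA′) + G 4F 5F * (G 0F 4F * DD′) ∎

      -- Extracting the signs from the six products.

      -- Reversed factors lose their signs in pairs, since the square of σ is 1; an odd number of
      -- reversals leaves a single σ in front.
      unsign : ∀ {t u s v w} → t ≈ σ * u → s ≈ σ * v → t * (s * w) ≈ u * (v * w)
      unsign {t} {u} {s} {v} {w} t≈σu s≈σv = begin
        t * (s * w)                  ≈⟨ *-cong t≈σu (*-congʳ s≈σv) ⟩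
        σ * u * (σ * v * w)          ≈⟨ solve 4 (λ σ u v w →
          σ :* u :* (σ :* v :* w) := σ :* σ :* (u :* (v :* w))) refl σ u v w ⟩
        σ * σ * (u * (v * w))        ≈⟨ *-congʳ (Sign⇒σ*σ≈1 σ-sign) ⟩
        1# * (u * (v * w))           ≈⟨ *-identityˡ (u * (v * w)) ⟩
        u * (v * w)                  ∎
        where open import Relation.Binary.Reasoning.Setoid setoid

      flip : ∀ i j → G j i ≈ σ * G i j
      flip i j = trans
        (g-cong (solve 2 (λ p q → q :- p := :- (p :- q)) refl (x i) (x j)))
        (g-parity (x i - x j))

      row : Fin 6 → Carrier
      row i = product (removeAt (λ j → g (x i - x j)) i)

      -- The iterated product ends in a factor `1#`, which is dropped here.
      product₅ : ∀ {p q r s t} → p * (q * (r * (s * (t * 1#)))) ≈ p * (q * (r * (s * t)))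
      product₅ = *-congˡ (*-congˡ (*-congˡ (*-congˡ (*-identityʳ _))))

      σ-out : ∀ {t u w} → t ≈ σ * u → t * w ≈ σ * (u * w)
      σ-out {u = u} {w} t≈σu = trans (*-congʳ t≈σu) (*-assoc σ u w)

      row₀ : row 0F ≈ P 0F
      row₀ = product₅

      row₁ : row 1F ≈ σ * P 1F
      row₁ = trans product₅ (σ-out (flip 0F 1F))

      row₂ : row 2F ≈ P 2F
      row₂ = trans product₅ (unsign (flip 0F 2F) (flip 1F 2F))

      row₃ : row 3F ≈ σ * P 3F
      row₃ = trans product₅ (trans (σ-out (flip 0F 3F))
        (*-congˡ (*-congˡ (unsign (flip 1F 3F) (flip 2F 3F)))))

      row₄ : row 4F ≈ P 4F
      row₄ = trans product₅ (trans (unsign (flip 0F 4F) (flip 1F 4F))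
        (*-congˡ (*-congˡ (unsign (flip 2F 4F) (flip 3F 4F)))))

      row₅ : row 5F ≈ σ * P 5F
      row₅ = trans product₅ (trans (unsign (flip 0F 5F) (flip 1F 5F)) (trans
        (*-congˡ (*-congˡ (trans (unsign (flip 2F 5F) (flip 3F 5F))
          (*-congˡ (*-congˡ (flip 4F 5F))))))
        -- Four of the five reversals have cancelled; the sign of the last factor is moved to the
        -- front.
        (solve 6 (λ σ p q r s t →
          p :* (q :* (r :* (s :* (σ :* t)))) := σ :* (p :* (q :* (r :* (s :* t))))) refl
          σ (G 0F 5F) (G 1F 5F) (G 2F 5F) (G 3F 5F) (G 4F 5F))))

    -- Here `b₁` and `b₃` stand for the absolute values of a₁ and a₃. For a₅ the coefficient a₄
    -- itself serves as the bound.
    0≤∑aᵢ∏g : (a : Vector Carrier 6) {b₁ b₃ : Carrier} →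
      b₁ ≤ a 0F → a 1F ≤ b₁ → - a 1F ≤ b₁ → a 4F ≤ b₁ →
      0# ≤ a 4F → a 5F ≤ a 4F → - a 5F ≤ a 4F →
      b₃ ≤ a 2F → 0# ≤ b₃ → a 3F ≤ b₃ → - a 3F ≤ b₃ →
      0# ≤ sum (λ i → a i * product (removeAt (λ j → g (x i - x j)) i))
    0≤∑aᵢ∏g a {b₁} {b₃} b₁≤a₀ a₁≤b₁ -a₁≤b₁ a₄≤b₁ 0≤a₄ a₅≤a₄ -a₅≤a₄ b₃≤a₂ 0≤b₃ a₃≤b₃ -a₃≤b₃ = begin
      0#
        ≲⟨ x≤y⇒0≤y-x b₁≤a₀ · 0≤P 0F ⊕ Sign⇒0≤y+σ*x σ-sign a₁≤b₁ -a₁≤b₁ · 0≤P 1F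
           ⊕ x≤y⇒0≤y-x b₃≤a₂ · 0≤P 2F ⊕ Sign⇒0≤y+σ*x σ-sign a₃≤b₃ -a₃≤b₃ · 0≤P 3F
           ⊕ Sign⇒0≤y+σ*x σ-sign a₅≤a₄ -a₅≤a₄ · 0≤P 5F
           ⊕ x≤y⇒0≤y-x a₄≤b₁ · x≤y⇒0≤y-x P₁≤P₀
           ⊕ 0≤a₄ · x≤y⇒0≤y-x P₅+P₁≤P₀+P₄
           ⊕ 0≤b₃ · x≤y⇒0≤y-x P₃≤P₂ ⟩
      (a 0F - b₁) * P 0F + ((b₁ + σ * a 1F) * P 1F
        + ((a 2F - b₃) * P 2F + ((b₃ + σ * a 3F) * P 3F
        + ((a 4F + σ * a 5F) * P 5F
        + ((b₁ - a 4F) * (P 0F - P 1F)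
        + (a 4F * (P 0F + P 4F - (P 5F + P 1F))
        + b₃ * (P 2F - P 3F)))))))
        ≈⟨ solve 15 (λ σ a₀ a₁ a₂ a₃ a₄ a₅ b₁ b₃ p₀ p₁ p₂ p₃ p₄ p₅ →
             (a₀ :- b₁) :* p₀ :+ ((b₁ :+ σ :* a₁) :* p₁
               :+ ((a₂ :- b₃) :* p₂ :+ ((b₃ :+ σ :* a₃) :* p₃
               :+ ((a₄ :+ σ :* a₅) :* p₅
               :+ ((b₁ :- a₄) :* (p₀ :- p₁)
               :+ (a₄ :* (p₀ :+ p₄ :- (p₅ :+ p₁))
               :+ b₃ :* (p₂ :- p₃)))))))
             := a₀ :* p₀ :+ (a₁ :* (σ :* p₁) :+ (a₂ :* p₂
               :+ (a₃ :* (σ :* p₃) :+ (a₄ :* p₄ :+ a₅ :* (σ :* p₅))))))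
             refl σ (a 0F) (a 1F) (a 2F) (a 3F) (a 4F) (a 5F) b₁ b₃
             (P 0F) (P 1F) (P 2F) (P 3F) (P 4F) (P 5F) ⟩
      a 0F * P 0F + (a 1F * (σ * P 1F) + (a 2F * P 2F
        + (a 3F * (σ * P 3F) + (a 4F * P 4F + a 5F * (σ * P 5F)))))
        ≈⟨ +-cong (*-congˡ row₀) (+-cong (*-congˡ row₁) (+-cong (*-congˡ row₂)
             (+-cong (*-congˡ row₃) (+-cong (*-congˡ row₄)
             -- The iterated sum ends in a summand `0#`.
             (trans (+-identityʳ _) (*-congˡ row₅)))))) ⟨
      sum (λ i → a i * row i) ∎
      where
      open ≤-Reasoning
      infixr 6 _⊕_
      _⊕_ : ∀ {u v} → 0# ≤ u → 0# ≤ v → 0# ≤ u + v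
      _⊕_ = 0≤+0≤⇒0≤

-- The Cauchy reals as a commutative ring.

open import Defs
open ≡ using (refl; sym; trans; cong; respˡ; respʳ)
open ℚ.+-*-Solver using (_:+_; _:*_; :-_; _:-_; _:=_) renaming (solve to ℚ-solve)

-- The common shape of `_≃_` and `_≤_` once ε is fixed.
Eventually : (ℕ → Set) → Set
Eventually P = ∃[ N ] ∀ n → N ℕ.≤ n → P n

always : ∀ {P} → (∀ n → P n) → Eventually P
always p = 0 , λ n _ → p n

eventually-map : ∀ {P Q : ℕ → Set} → (∀ n → P n → Q n) → Eventually P → Eventually Q
eventually-map f (N , p) = N , λ n N≤n → f n (p n N≤n)

eventually-map₂ : ∀ {P Q R : ℕ → Set} → (∀ n → P n → Q n → R n) →
  Eventually P → Eventually Q → Eventually R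
eventually-map₂ f (M , p) (N , q) = M ℕ.⊔ N , λ n M⊔N≤n →
  f n (p n (ℕ.m⊔n≤o⇒m≤o M N M⊔N≤n)) (q n (ℕ.m⊔n≤o⇒n≤o M N M⊔N≤n))

½ε+½ε≡ε : ∀ ε → ½ ℚ.* ε ℚ.+ ½ ℚ.* ε ≡ ε
½ε+½ε≡ε ε = trans (sym (ℚ.*-distribʳ-+ ε ½ ½)) (ℚ.*-identityˡ ε)

0<½ε : ∀ {ε} → 0ℚ ℚ.< ε → 0ℚ ℚ.< ½ ℚ.* ε
0<½ε 0<ε = respˡ ℚ._<_ (ℚ.*-zeroʳ ½) (ℚ.*-monoʳ-<-pos ½ 0<ε)

rescale : ∀ {K ε} → 0ℚ ℚ.< K → 0ℚ ℚ.< ε → ∃[ δ ] 0ℚ ℚ.< δ × K ℚ.* δ ≡ ε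
rescale {K} {ε} 0<K 0<ε = δ , 0<δ , K*δ≡ε
  where
  instance
    K-pos = ℚ.positive 0<K
    K-nonZero = ℚ.pos⇒nonZero K
    1/K-pos = ℚ.1/pos⇒pos K
  δ = ℚ.1/ K ℚ.* ε
  0<δ = respˡ ℚ._<_ (ℚ.*-zeroʳ (ℚ.1/ K)) (ℚ.*-monoʳ-<-pos (ℚ.1/ K) 0<ε)
  K*δ≡ε = trans (sym (ℚ.*-assoc K (ℚ.1/ K) ε))
    (trans (cong (ℚ._* ε) (ℚ.*-inverseʳ K)) (ℚ.*-identityˡ ε))

≗⇒≃ : ∀ {x y} → (∀ n → seq x n ≡ seq y n) → x ≃ y
≗⇒≃ {x} {y} x≗y ε 0<ε = always λ n → respˡ ℚ._<_
  (sym (cong ℚ.∣_∣ (trans (cong (ℚ._- seq y n) (x≗y n)) (ℚ.+-inverseʳ (seq y n))))) 0<ε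

≤-pointwise : ∀ {x y} → (∀ n → seq x n ℚ.≤ seq y n) → x ≤ y
≤-pointwise {x} {y} x≤y ε 0<ε = always λ n →
  respˡ ℚ._<_ (ℚ.+-identityʳ (seq x n)) (ℚ.+-mono-≤-< (x≤y n) 0<ε)

+-cong : ∀ {x x′ y y′} → x ≃ x′ → y ≃ y′ → x + y ≃ x′ + y′
+-cong {x} {x′} {y} {y′} x≃x′ y≃y′ ε 0<ε = eventually-map₂
  (λ n → close (seq x n) (seq x′ n) (seq y n) (seq y′ n))
  (x≃x′ (½ ℚ.* ε) (0<½ε 0<ε)) (y≃y′ (½ ℚ.* ε) (0<½ε 0<ε))
  where
  close : ∀ p p′ q q′ → ℚ.∣ p ℚ.- p′ ∣ ℚ.< ½ ℚ.* ε → ℚ.∣ q ℚ.- q′ ∣ ℚ.< ½ ℚ.* ε →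
    ℚ.∣ p ℚ.+ q ℚ.- (p′ ℚ.+ q′) ∣ ℚ.< ε
  close p p′ q q′ p≈p′ q≈q′ = begin-strict
    ℚ.∣ p ℚ.+ q ℚ.- (p′ ℚ.+ q′) ∣            ≡⟨ cong ℚ.∣_∣ (ℚ-solve 4
      (λ p p′ q q′ → p :+ q :- (p′ :+ q′) := (p :- p′) :+ (q :- q′)) refl p p′ q q′) ⟩
    ℚ.∣ (p ℚ.- p′) ℚ.+ (q ℚ.- q′) ∣          ≤⟨ ℚ.∣p+q∣≤∣p∣+∣q∣ (p ℚ.- p′) (q ℚ.- q′) ⟩
    ℚ.∣ p ℚ.- p′ ∣ ℚ.+ ℚ.∣ q ℚ.- q′ ∣        <⟨ ℚ.+-mono-< p≈p′ q≈q′ ⟩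
    ½ ℚ.* ε ℚ.+ ½ ℚ.* ε                      ≡⟨ ½ε+½ε≡ε ε ⟩
    ε                                        ∎
    where open ℚ.≤-Reasoning

-‿cong : ∀ {x y} → x ≃ y → - x ≃ - y
-‿cong {x} {y} x≃y ε 0<ε = eventually-map
  (λ n → respˡ ℚ._<_ (trans (sym (ℚ.∣-p∣≡∣p∣ (seq x n ℚ.- seq y n)))
    (cong ℚ.∣_∣ (ℚ.neg-distrib-+ (seq x n) (ℚ.- seq y n)))))
  (x≃y ε 0<ε)

-- Termwise, pq - p′q′ = p (q - q′) + q′ (p - p′), so eventual bounds `K₁` on `x` and `K₂` on `y′`
-- allow δ = ε / (K₁ + K₂).
*-cong : ∀ {x x′ y y′} → x ≃ x′ → y ≃ y′ → x * y ≃ x′ * y′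
*-cong {x} {x′} {y} {y′} x≃x′ y≃y′ ε 0<ε =
  let K₁ , 0<K₁ , x-bounded  = eventually-bounded x
      K₂ , 0<K₂ , y′-bounded = eventually-bounded y′
      δ , 0<δ , Kδ≡ε         = rescale (ℚ.+-mono-< 0<K₁ 0<K₂) 0<ε
  in eventually-map₂
    (λ n (∣x∣≤K₁ , ∣y′∣≤K₂) (∣x-x′∣<δ , ∣y-y′∣<δ) → respʳ ℚ._<_ Kδ≡ε
      (close (seq x n) (seq x′ n) (seq y n) (seq y′ n) 0<K₁ 0<K₂
        ∣x∣≤K₁ ∣y′∣≤K₂ ∣x-x′∣<δ ∣y-y′∣<δ))
    (eventually-map₂ (λ _ → _,_) x-bounded y′-bounded)
    (eventually-map₂ (λ _ → _,_) (x≃x′ δ 0<δ) (y≃y′ δ 0<δ))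
  where
  ∣p*q∣<K*δ : ∀ p q {K δ} → 0ℚ ℚ.< K → ℚ.∣ p ∣ ℚ.≤ K → ℚ.∣ q ∣ ℚ.< δ →
    ℚ.∣ p ℚ.* q ∣ ℚ.< K ℚ.* δ
  ∣p*q∣<K*δ p q {K} {δ} 0<K ∣p∣≤K ∣q∣<δ = begin-strict
    ℚ.∣ p ℚ.* q ∣          ≡⟨ ℚ.∣p*q∣≡∣p∣*∣q∣ p q ⟩
    ℚ.∣ p ∣ ℚ.* ℚ.∣ q ∣    ≤⟨ ℚ.*-monoʳ-≤-nonNeg ℚ.∣ q ∣ {{ℚ.∣-∣-nonNeg q}} ∣p∣≤K ⟩
    K ℚ.* ℚ.∣ q ∣          <⟨ ℚ.*-monoʳ-<-pos K {{ℚ.positive 0<K}} ∣q∣<δ ⟩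
    K ℚ.* δ                ∎
    where open ℚ.≤-Reasoning

  close : ∀ p p′ q q′ {K₁ K₂ δ} → 0ℚ ℚ.< K₁ → 0ℚ ℚ.< K₂ →
    ℚ.∣ p ∣ ℚ.≤ K₁ → ℚ.∣ q′ ∣ ℚ.≤ K₂ → ℚ.∣ p ℚ.- p′ ∣ ℚ.< δ → ℚ.∣ q ℚ.- q′ ∣ ℚ.< δ →
    ℚ.∣ p ℚ.* q ℚ.- p′ ℚ.* q′ ∣ ℚ.< (K₁ ℚ.+ K₂) ℚ.* δ
  close p p′ q q′ {K₁} {K₂} {δ} 0<K₁ 0<K₂ ∣p∣≤K₁ ∣q′∣≤K₂ p≈p′ q≈q′ = begin-strict
    ℚ.∣ p ℚ.* q ℚ.- p′ ℚ.* q′ ∣                              ≡⟨ cong ℚ.∣_∣ (ℚ-solve 4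
      (λ p p′ q q′ → p :* q :- p′ :* q′ := p :* (q :- q′) :+ q′ :* (p :- p′)) refl p p′ q q′) ⟩
    ℚ.∣ p ℚ.* (q ℚ.- q′) ℚ.+ q′ ℚ.* (p ℚ.- p′) ∣             ≤⟨ ℚ.∣p+q∣≤∣p∣+∣q∣ (p ℚ.* (q ℚ.- q′)) (q′ ℚ.* (p ℚ.- p′)) ⟩
    ℚ.∣ p ℚ.* (q ℚ.- q′) ∣ ℚ.+ ℚ.∣ q′ ℚ.* (p ℚ.- p′) ∣       <⟨ ℚ.+-mono-<
      (∣p*q∣<K*δ p (q ℚ.- q′) 0<K₁ ∣p∣≤K₁ q≈q′) (∣p*q∣<K*δ q′ (p ℚ.- p′) 0<K₂ ∣q′∣≤K₂ p≈p′) ⟩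
    K₁ ℚ.* δ ℚ.+ K₂ ℚ.* δ                                    ≡⟨ ℚ.*-distribʳ-+ δ K₁ K₂ ⟨
    (K₁ ℚ.+ K₂) ℚ.* δ                                        ∎
    where open ℚ.≤-Reasoning

-- The ring laws hold term by term in the rationals; only the congruences involve ε.
+-*-commutativeRing : CommutativeRing 0ℓ 0ℓ
+-*-commutativeRing = record
  { Carrier = ℝ ; _≈_ = _≃_ ; _+_ = _+_ ; _*_ = _*_ ; -_ = -_ ; 0# = 0ℝ ; 1# = 1ℝ
  ; isCommutativeRing = record
    { isRing = record
      { +-isAbelianGroup = record
        { isGroup = record
          { isMonoid = record
            { isSemigroup = record
              { isMagma = record
                { isEquivalence = Setoid.isEquivalence ℝ-setoid
                ; ∙-cong = λ {x} {x′} {y} {y′} → +-cong {x} {x′} {y} {y′}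
                }
              ; assoc = λ x y z → ≗⇒≃ {x + y + z} {x + (y + z)} λ n →
                  ℚ.+-assoc (seq x n) (seq y n) (seq z n)
              }
            ; identity =
                (λ x → ≗⇒≃ {0ℝ + x} {x} λ n → ℚ.+-identityˡ (seq x n))
              , (λ x → ≗⇒≃ {x + 0ℝ} {x} λ n → ℚ.+-identityʳ (seq x n))
            }
          ; inverse =
              (λ x → ≗⇒≃ {(- x) + x} {0ℝ} λ n → ℚ.+-inverseˡ (seq x n))
            , (λ x → ≗⇒≃ {x - x} {0ℝ} λ n → ℚ.+-inverseʳ (seq x n))
          ; ⁻¹-cong = λ {x} {y} → -‿cong {x} {y}
          }
        ; comm = λ x y → ≗⇒≃ {x + y} {y + x} λ n → ℚ.+-comm (seq x n) (seq y n)
        }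
      ; *-cong = λ {x} {x′} {y} {y′} → *-cong {x} {x′} {y} {y′}
      ; *-assoc = λ x y z → ≗⇒≃ {x * y * z} {x * (y * z)} λ n →
          ℚ.*-assoc (seq x n) (seq y n) (seq z n)
      ; *-identity =
          (λ x → ≗⇒≃ {1ℝ * x} {x} λ n → ℚ.*-identityˡ (seq x n))
        , (λ x → ≗⇒≃ {x * 1ℝ} {x} λ n → ℚ.*-identityʳ (seq x n))
      ; distrib =
          (λ x y z → ≗⇒≃ {x * (y + z)} {x * y + x * z} λ n →
            ℚ.*-distribˡ-+ (seq x n) (seq y n) (seq z n))
        , (λ x y z → ≗⇒≃ {(y + z) * x} {y * x + z * x} λ n →
            ℚ.*-distribʳ-+ (seq x n) (seq y n) (seq z n))
      }
    ; *-comm = λ x y → ≗⇒≃ {x * y} {y * x} λ n → ℚ.*-comm (seq x n) (seq y n)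
    }
  }

-- The order on the Cauchy reals.

≤-trans : ∀ {x y z} → x ≤ y → y ≤ z → x ≤ z
≤-trans {x} {y} {z} x≤y y≤z ε 0<ε = eventually-map₂
  (λ n x<y+½ε y<z+½ε → begin-strict
    seq x n                                   <⟨ x<y+½ε ⟩
    seq y n ℚ.+ ½ ℚ.* ε                       <⟨ ℚ.+-monoˡ-< (½ ℚ.* ε) y<z+½ε ⟩
    seq z n ℚ.+ ½ ℚ.* ε ℚ.+ ½ ℚ.* ε           ≡⟨ ℚ.+-assoc (seq z n) (½ ℚ.* ε) (½ ℚ.* ε) ⟩
    seq z n ℚ.+ (½ ℚ.* ε ℚ.+ ½ ℚ.* ε)         ≡⟨ cong (seq z n ℚ.+_) (½ε+½ε≡ε ε) ⟩
    seq z n ℚ.+ ε                             ∎)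
  (x≤y (½ ℚ.* ε) (0<½ε 0<ε)) (y≤z (½ ℚ.* ε) (0<½ε 0<ε))
  where open ℚ.≤-Reasoning

p≤∣p∣ : ∀ p → p ℚ.≤ ℚ.∣ p ∣
p≤∣p∣ p with ℚ.∣p∣≡p∨∣p∣≡-p p
... | inj₁ ∣p∣≡p  = ℚ.≤-reflexive (sym ∣p∣≡p)
... | inj₂ ∣p∣≡-p = begin
  p            ≡⟨ ℚ-solve 1 (λ p → p := :- (:- p)) refl p ⟩
  ℚ.- ℚ.- p    ≡⟨ cong ℚ.-_ ∣p∣≡-p ⟨
  ℚ.- ℚ.∣ p ∣  ≤⟨ ℚ.neg-antimono-≤ (ℚ.0≤∣p∣ p) ⟩
  0ℚ           ≤⟨ ℚ.0≤∣p∣ p ⟩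
  ℚ.∣ p ∣      ∎
  where open ℚ.≤-Reasoning

-p≤∣p∣ : ∀ p → ℚ.- p ℚ.≤ ℚ.∣ p ∣
-p≤∣p∣ p = respʳ ℚ._≤_ (ℚ.∣-p∣≡∣p∣ p) (p≤∣p∣ (ℚ.- p))

≃⇒≤ : ∀ {x y} → x ≃ y → x ≤ y
≃⇒≤ {x} {y} x≃y ε 0<ε = eventually-map
  (λ n ∣x-y∣<ε → begin-strict
    seq x n                                   ≡⟨ ℚ-solve 2 (λ p q → p := q :+ (p :- q)) refl (seq x n) (seq y n) ⟩
    seq y n ℚ.+ (seq x n ℚ.- seq y n)         ≤⟨ ℚ.+-monoʳ-≤ (seq y n) (p≤∣p∣ (seq x n ℚ.- seq y n)) ⟩
    seq y n ℚ.+ ℚ.∣ seq x n ℚ.- seq y n ∣     <⟨ ℚ.+-monoʳ-< (seq y n) ∣x-y∣<ε ⟩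
    seq y n ℚ.+ ε                             ∎)
  (x≃y ε 0<ε)
  where open ℚ.≤-Reasoning

+-monoˡ-≤ : ∀ z {x y} → x ≤ y → x + z ≤ y + z
+-monoˡ-≤ z {x} {y} x≤y ε 0<ε = eventually-map
  (λ n x<y+ε → respʳ ℚ._<_
    (ℚ-solve 3 (λ q e r → q :+ e :+ r := q :+ r :+ e) refl (seq y n) ε (seq z n))
    (ℚ.+-monoˡ-< (seq z n) x<y+ε))
  (x≤y ε 0<ε)

-- A nonnegative real may have negative terms, but eventually each lies above -ε/2, and a negative
-- term differs from its absolute value by twice its size.
0≤x⇒x≃∣x∣ : ∀ {x} → 0ℝ ≤ x → x ≃ ∣ x ∣
0≤x⇒x≃∣x∣ {x} 0≤x ε 0<ε = eventually-map (λ n → close (seq x n)) (0≤x (½ ℚ.* ε) (0<½ε 0<ε))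
  where
  open ℚ.≤-Reasoning
  close : ∀ p → 0ℚ ℚ.< p ℚ.+ ½ ℚ.* ε → ℚ.∣ p ℚ.- ℚ.∣ p ∣ ∣ ℚ.< ε
  close p 0<p+½ε with ℚ.∣p∣≡p∨∣p∣≡-p p
  ... | inj₁ ∣p∣≡p = respˡ ℚ._<_
    (sym (cong ℚ.∣_∣ (trans (cong (ℚ._-_ p) ∣p∣≡p) (ℚ.+-inverseʳ p)))) 0<ε
  ... | inj₂ ∣p∣≡-p = begin-strict
    ℚ.∣ p ℚ.- ℚ.∣ p ∣ ∣                           ≤⟨ ℚ.∣p-q∣≤∣p∣+∣q∣ p ℚ.∣ p ∣ ⟩
    ℚ.∣ p ∣ ℚ.+ ℚ.∣ ℚ.∣ p ∣ ∣                     ≡⟨ cong (ℚ.∣ p ∣ ℚ.+_) (ℚ.∣∣p∣∣≡∣p∣ p) ⟩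
    ℚ.∣ p ∣ ℚ.+ ℚ.∣ p ∣                           <⟨ ℚ.+-mono-< ∣p∣<½ε ∣p∣<½ε ⟩
    ½ ℚ.* ε ℚ.+ ½ ℚ.* ε                           ≡⟨ ½ε+½ε≡ε ε ⟩
    ε                                             ∎
    where
    ∣p∣<½ε = begin-strict
      ℚ.∣ p ∣                         ≡⟨ ∣p∣≡-p ⟩
      ℚ.- p                           ≡⟨ ℚ.+-identityˡ (ℚ.- p) ⟨
      0ℚ ℚ.- p                        <⟨ ℚ.+-monoˡ-< (ℚ.- p) 0<p+½ε ⟩
      p ℚ.+ ½ ℚ.* ε ℚ.- p             ≡⟨ ℚ-solve 2 (λ p e → p :+ e :- p := e) refl p (½ ℚ.* ε) ⟩
      ½ ℚ.* ε                         ∎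

0≤∣x∣ : ∀ x → 0ℝ ≤ ∣ x ∣
0≤∣x∣ x = ≤-pointwise {0ℝ} {∣ x ∣} λ n → ℚ.0≤∣p∣ (seq x n)

x≤∣x∣ : ∀ x → x ≤ ∣ x ∣
x≤∣x∣ x = ≤-pointwise {x} {∣ x ∣} λ n → p≤∣p∣ (seq x n)

-x≤∣x∣ : ∀ x → - x ≤ ∣ x ∣
-x≤∣x∣ x = ≤-pointwise { - x} {∣ x ∣} λ n → -p≤∣p∣ (seq x n)

-- Terms of nonnegative reals can be negative, so both factors are first replaced by their absolute
-- values, whose product is nonnegative term by term.
0≤*0≤⇒0≤ : ∀ {x y} → 0ℝ ≤ x → 0ℝ ≤ y → 0ℝ ≤ x * y
0≤*0≤⇒0≤ {x} {y} 0≤x 0≤y = ≤-trans {0ℝ} {∣ x ∣ * ∣ y ∣} {x * y}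
  (≤-pointwise {0ℝ} {∣ x ∣ * ∣ y ∣} λ n →
    respʳ ℚ._≤_ (ℚ.∣p*q∣≡∣p∣*∣q∣ (seq x n) (seq y n)) (ℚ.0≤∣p∣ (seq x n ℚ.* seq y n)))
  (≃⇒≤ {∣ x ∣ * ∣ y ∣} {x * y} (≃-sym {x * y} {∣ x ∣ * ∣ y ∣}
    (*-cong {x} {∣ x ∣} {y} {∣ y ∣} (0≤x⇒x≃∣x∣ {x} 0≤x) (0≤x⇒x≃∣x∣ {y} 0≤y))))

-- Transfer of the inequality to the reals.

ℝ-orderedℚAlgebra : OrderedℚAlgebra 0ℓ 0ℓ 0ℓ
ℝ-orderedℚAlgebra = record
  { commutativeRing = +-*-commutativeRing
  ; embedding = record
    { ⟦_⟧    = fromℚ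
    ; +-homo = λ p q → ≗⇒≃ {fromℚ (p ℚ.+ q)} {fromℚ p + fromℚ q} λ _ → refl
    ; *-homo = λ p q → ≗⇒≃ {fromℚ (p ℚ.* q)} {fromℚ p * fromℚ q} λ _ → refl
    ; -‿homo = λ p → ≗⇒≃ {fromℚ (ℚ.- p)} { - fromℚ p} λ _ → refl
    ; 0-homo = ≃-refl {0ℝ}
    ; 1-homo = ≃-refl {1ℝ}
    }
  ; _≤_ = _≤_
  ; isPreorder = record
    { isEquivalence = Setoid.isEquivalence ℝ-setoid
    ; reflexive     = λ {x} {y} → ≃⇒≤ {x} {y}
    ; trans         = λ {x} {y} {z} → ≤-trans {x} {y} {z}
    }
  ; +-monoˡ-≤ = λ z {x} {y} → +-monoˡ-≤ z {x} {y}
  ; 0≤*0≤⇒0≤  = λ {x} {y} → 0≤*0≤⇒0≤ {x} {y}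
  }

module ℝ-Properties = OrderedAlgebraProperties ℝ-orderedℚAlgebra

parity-sign : ∀ f → let open Func f using () renaming (to to g) in
  Even f ⊎ Odd f → ∃[ σ ] ℝ-Properties.Sign σ × (∀ x → g (- x) ≃ σ * g x)
parity-sign f (inj₁ even) = 1ℝ , inj₁ (≃-refl {1ℝ}) , λ x →
  ≃-trans {g (- x)} {g x} {1ℝ * g x} (even x) (≃-sym {1ℝ * g x} {g x} (*-identityˡ (g x)))
  where
  open Func f using () renaming (to to g)
  open CommutativeRing +-*-commutativeRing using (*-identityˡ)
parity-sign f (inj₂ odd) = - 1ℝ , inj₂ (≃-refl { - 1ℝ}) , λ x →
  ≃-trans {g (- x)} { - g x} { - 1ℝ * g x} (odd x)
    (≃-sym { - 1ℝ * g x} { - g x} (-1*x≈-x (g x)))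
  where
  open Func f using () renaming (to to g)
  open RingProperties (CommutativeRing.ring +-*-commutativeRing) using (-1*x≈-x)

theorem4 : (x : Vector ℝ 6) →
    x 0F ≥ x 1F → x 1F ≥ x 2F → x 2F ≥ x 3F → x 3F ≥ x 4F → x 4F ≥ x 5F →
    x 0F + x 5F ≥ x 1F + x 4F →
    x 1F + x 4F ≥ x 2F + x 3F →
    (a : Vector ℝ 6) →
    a 0F ≥ ∣ a 1F ∣ → ∣ a 1F ∣ ≥ a 4F → a 4F ≥ ∣ a 5F ∣ →
    a 2F ≥ ∣ a 3F ∣ →
    (g : RealFunction) → 𝒢₂ g →
    let open Func g using (to) in
    sum (λ i → a i * product (removeAt (λ j → to (x i - x j)) i)) ≥ 0ℝ
theorem4 x x₁≤x₀ x₂≤x₁ x₃≤x₂ x₄≤x₃ x₅≤x₄ x₁+x₄≤x₀+x₅ x₂+x₃≤x₁+x₄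
  a ∣a₁∣≤a₀ a₄≤∣a₁∣ ∣a₅∣≤a₄ ∣a₃∣≤a₂ g ((parity , 0≤g0 , mono) , product-ineq , sum-ineq) =
  let σ , σ-sign , g-parity = parity-sign g parity in
  ℝ-Properties.0≤∑aᵢ∏g (Func.to g) (λ {x} {y} → Func.cong g {x} {y}) {σ} σ-sign g-parity
    0≤g0 mono product-ineq sum-ineq
    x x₁≤x₀ x₂≤x₁ x₃≤x₂ x₄≤x₃ x₅≤x₄ x₁+x₄≤x₀+x₅ x₂+x₃≤x₁+x₄
    a {∣ a 1F ∣} {∣ a 3F ∣}
    ∣a₁∣≤a₀ (x≤∣x∣ (a 1F)) (-x≤∣x∣ (a 1F)) a₄≤∣a₁∣
    -- The sign of a₄ and both bounds on a₅ come from a₄ ≥ |a₅|.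
    (≤-trans {0ℝ} {∣ a 5F ∣} {a 4F} (0≤∣x∣ (a 5F)) ∣a₅∣≤a₄)
    (≤-trans {a 5F} {∣ a 5F ∣} {a 4F} (x≤∣x∣ (a 5F)) ∣a₅∣≤a₄)
    (≤-trans { - a 5F} {∣ a 5F ∣} {a 4F} (-x≤∣x∣ (a 5F)) ∣a₅∣≤a₄)
    ∣a₃∣≤a₂ (0≤∣x∣ (a 3F)) (x≤∣x∣ (a 3F)) (-x≤∣x∣ (a 3F))
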